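{- Let $G=(V,A)$ be a flow graph with start vertex $s$, let $F$ be a depth-first spanning tree of $G$ rooted at $s$ with vertices identified with their preorder numbers $1,\dots,n$, and let $f(v)$ be the parent of $v$ in $F$. For each $v\neq s$ let $\mathit{sd}(v)$, $\mathit{rd}(v)$ and $g(v)$ be as defined below. Process the vertices $v\neq s$ in increasing order: if $\mathit{sd}(v)=\mathit{sd}(\mathit{rd}(v))$ or $b(\mathit{rd}(v))=f(\mathit{rd}(v))$, set $b(v)=g(v)$ and $r(v)=f(v)$; otherwise set $b(v)=f(v)$ and $r(v)=g(v)$. Let $B$ (resp. $R$) be the graph with vertex set $V$ and arcs $(b(v),v)$ (resp. $(r(v),v)$) for $v\neq s$. Then both $B$ and $R$ are spanning trees rooted at $s$.
   Context: A flow graph is a finite directed graph $G=(V,A)$ with start vertex $s$ such that every vertex is reachable from $s$; there are no arcs entering $s$ and $n=|V|>1$. A path from $u$ to $v$ is high if all its vertices other than $u$ and $v$ are greater (in the preorder numbering of $F$) than both $u$ and $v$. For $v\neq s$, the semi-dominator $\mathit{sd}(v)$ is the minimum vertex $u$ such that there is a high path from $u$ to $v$. For $v\neq s$, $F(\mathit{sd}(v),v]$ denotes the path in $F$ from the child of $\mathit{sd}(v)$ that is an ancestor of $v$ down to $v$; the relative dominator $\mathit{rd}(v)$ is the vertex $x$ on $F(\mathit{sd}(v),v]$ with $\mathit{sd}(x)$ minimum, ties broken in favor of the smallest $x$. For each $v\neq s$, $(g(v),v)\in A$ is an arc that is the last arc on some high path from $\mathit{sd}(v)$ to $v$. -}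

module Defs where

open import Data.Nat using (ℕ; suc) renaming (_≤_ to _≤ℕ_)
open import Data.Fin using (Fin; zero; suc; inject₁; _<_; _≤_)
open import Data.Product using (Σ; _×_)
open import Data.Sum using (_⊎_)
open import Relation.Binary.PropositionalEquality using (_≡_; _≢_)
open import Relation.Nullary using (¬_)

-- Vertices are Fin (suc m), identified with their preorder numbers in F
-- (Fin index 0 = preorder number 1).  The start vertex s is zero.
-- A graph is given by its arc relation  Arc u v  ("(u,v) ∈ A").

module _ {m : ℕ} (Arc : Fin (suc m) → Fin (suc m) → Set) where

  data Reachable : Fin (suc m) → Fin (suc m) → Set where
    here : ∀ {u} → Reachable u u
    step : ∀ {u v w} → Reachable u v → Arc v w → Reachable u w

  record IsFlowGraph : Set where
    field
      nontrivial  : 1 ≤ℕ m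
      reachable   : ∀ v → Reachable zero v
      noArcIntoS  : ∀ u → ¬ Arc u zero

  data PathVia (P : Fin (suc m) → Set) : Fin (suc m) → Fin (suc m) → Fin (suc m) → Set where
    edge : ∀ {x y} → Arc x y → PathVia P x y x
    cons : ∀ {x y z w} → Arc x y → P y → PathVia P y z w → PathVia P x z w

  HighPathLast : Fin (suc m) → Fin (suc m) → Fin (suc m) → Set
  HighPathLast u v w = PathVia (λ x → (u < x) × (v < x)) u v w

  HighPath : Fin (suc m) → Fin (suc m) → Set
  HighPath u v = Σ (Fin (suc m)) (λ w → HighPathLast u v w)

-- Trees given by a parent function p (p v meaningful for v ≠ zero):
-- the graph with arcs (p v , v), v ≠ s.
module _ {m : ℕ} (p : Fin (suc m) → Fin (suc m)) where

  data Reach : Fin (suc m) → Set where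
    root : Reach zero
    step : ∀ {v} → v ≢ zero → Reach (p v) → Reach v

  -- The graph with vertex set V and arcs (p v , v) (v ≠ s) is a spanning
  -- tree rooted at s: each v ≠ s has exactly one entering arc, s none,
  -- and every vertex is reachable from s.
  IsSpanningTreeFrom0 : Set
  IsSpanningTreeFrom0 = ∀ v → Reach v

  data AncEq (u : Fin (suc m)) : Fin (suc m) → Set where
    self : AncEq u u
    up   : ∀ {v} → v ≢ zero → AncEq u (p v) → AncEq u v

  -- OnPath a v x : x lies on the tree path p(a, v], i.e. x is an
  -- ancestor-or-self of v and a proper descendant of a.
  OnPath : Fin (suc m) → Fin (suc m) → Fin (suc m) → Set
  OnPath a v x = AncEq x v × (x ≢ zero) × AncEq a (p x)

-- F (parent function f) is a depth-first spanning tree of G rooted at s,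
-- with vertices numbered in preorder:
--  * arcs (f v , v) are arcs of G and form a spanning tree rooted at s;
--  * the numbering is a preorder of F: the parent of vertex v+1 is an
--    ancestor-or-self of vertex v;
--  * depth-first property: for every arc (u , w) of G with u < w
--    (in preorder), u is an ancestor of w in F.
record IsDFSTree {m : ℕ} (Arc : Fin (suc m) → Fin (suc m) → Set)
                 (f : Fin (suc m) → Fin (suc m)) : Set where
  field
    treeArcs  : ∀ v → v ≢ zero → Arc (f v) v
    spanning  : IsSpanningTreeFrom0 f
    preorder  : ∀ (v : Fin m) → AncEq f (f (suc v)) (inject₁ v)
    dfs       : ∀ u w → Arc u w → u < w → AncEq f u w

module _ {m : ℕ} (Arc : Fin (suc m) → Fin (suc m) → Set)
         (f : Fin (suc m) → Fin (suc m)) where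

  IsSd : (Fin (suc m) → Fin (suc m)) → Set
  IsSd sd = ∀ v → v ≢ zero →
    HighPath Arc (sd v) v × (∀ u → HighPath Arc u v → sd v ≤ u)

  IsRd : (Fin (suc m) → Fin (suc m)) → (Fin (suc m) → Fin (suc m)) → Set
  IsRd sd rd = ∀ v → v ≢ zero →
    OnPath f (sd v) v (rd v) ×
    (∀ x → OnPath f (sd v) v x →
       (sd (rd v) < sd x) ⊎ ((sd (rd v) ≡ sd x) × (rd v ≤ x)))

  IsG : (Fin (suc m) → Fin (suc m)) → (Fin (suc m) → Fin (suc m)) → Set
  IsG sd g = ∀ v → v ≢ zero → HighPathLast Arc (sd v) v (g v)

  Cond : (sd rd b : Fin (suc m) → Fin (suc m)) → Fin (suc m) → Set
  Cond sd rd b v = (sd v ≡ sd (rd v)) ⊎ (b (rd v) ≡ f (rd v))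

  -- b and r are the result of processing the vertices v ≠ s in increasing
  -- order (the equations determine b, r on v ≠ s uniquely, since
  -- rd v ≤ v and Cond holds trivially when rd v = v).
  IsBR : (sd rd g b r : Fin (suc m) → Fin (suc m)) → Set
  IsBR sd rd g b r = ∀ v → v ≢ zero →
    (Cond sd rd b v → (b v ≡ g v) × (r v ≡ f v)) ×
    (¬ Cond sd rd b v → (b v ≡ f v) × (r v ≡ g v))

{-# OPTIONS --safe #-}
-- Let t v say whether v takes g v (rather than f v) as its parent.  Along the map rd the
-- value of t alternates as long as sd strictly decreases, and it is a constant c where sd
-- stays equal; B and R differ only in swapping true and false, so both follow from the
-- same argument.
--
-- Suppose the parent map p has a cycle with minimum vertex z.  Then z is an ancestor of
-- the whole cycle, p z = g z, and no vertex on a tree path from z to the cycle has its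
-- semi-dominator below sd z, since that would extend to a high path to z.  Call a
-- descendant v of z good if the vertex u on F(z,v] with minimum sd satisfies sd u < z and
-- t u = true.  By alternation, goodness passes from g z along p: the only delicate step
-- is v with sd v < z and p v = g v, where the new minimum semi-dominator lies between
-- those of u and v and a convexity property of t applies.  But z itself is not good.
module Submission where

open import Defs
open import Data.Nat using (ℕ; suc; z≤n; s≤s)
import Data.Nat.Properties as ℕₚ
open import Data.Bool using (Bool; true; false; not)
open import Data.Bool.Properties using (not-injective; not-¬)
open import Data.Fin using (Fin; zero; suc; inject₁; fromℕ; _<_; _≤_)
open import Data.Fin.Properties
  using (_≟_; _<?_; <-cmp; ≤-refl; ≤-reflexive; ≤-trans; ≤-antisym; ≤-total; <-trans;
         <-irrefl; <⇒≢; ≤∧≢⇒<; toℕ-inject₁; ≤fromℕ)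
open import Data.Fin.Induction using (<-wellFounded; >-weakInduction)
open import Data.Product using (∃; _×_; _,_; proj₁; proj₂)
open import Data.Sum using (_⊎_; inj₁; inj₂; map₂)
open import Data.Empty using (⊥-elim)
open import Function using (_∘_)
open import Induction.WellFounded using (Acc; acc)
open import Relation.Binary using (tri<; tri≈; tri>)
open import Relation.Binary.PropositionalEquality
  using (_≡_; _≢_; refl; sym; trans; cong; subst)
open import Relation.Nullary using (¬_; Dec; yes; no; does; proof; Reflects; invert)
open import Relation.Nullary.Decidable using (_⊎-dec_; dec-true; dec-false)

-- Order on `Fin`.

≮⇒≥ : ∀ {n} {i j : Fin n} → ¬ i < j → j ≤ i
≮⇒≥ = ℕₚ.≮⇒≥

<-≤-trans : ∀ {n} {i j k : Fin n} → i < j → j ≤ k → i < k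
<-≤-trans = ℕₚ.<-≤-trans

≤-<-trans : ∀ {n} {i j k : Fin n} → i ≤ j → j < k → i < k
≤-<-trans = ℕₚ.≤-<-trans

<⇒≤ : ∀ {n} {i j : Fin n} → i < j → i ≤ j
<⇒≤ = ℕₚ.<⇒≤

<⇒≱ : ∀ {n} {i j : Fin n} → i < j → ¬ j ≤ i
<⇒≱ = ℕₚ.<⇒≱

<⇒≢0 : ∀ {n} {i j : Fin (suc n)} → i < j → j ≢ zero
<⇒≢0 () refl

<-suc⇒≤-inject₁ : ∀ {n} {u : Fin (suc n)} {i : Fin n} → u < suc i → u ≤ inject₁ i
<-suc⇒≤-inject₁ {i = i} (s≤s u≤i) = ℕₚ.≤-trans u≤i (ℕₚ.≤-reflexive (sym (toℕ-inject₁ i)))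

≤-inject₁⇒<-suc : ∀ {n} {u : Fin (suc n)} {i : Fin n} → u ≤ inject₁ i → u < suc i
≤-inject₁⇒<-suc {i = i} u≤i = s≤s (ℕₚ.≤-trans u≤i (ℕₚ.≤-reflexive (toℕ-inject₁ i)))

-- Concatenation of paths.

module _ {m : ℕ} {Arc : Fin (suc m) → Fin (suc m) → Set} where

  PathVia-map : ∀ {P Q : Fin (suc m) → Set} {x y w} →
    (∀ {i} → P i → Q i) → PathVia Arc P x y w → PathVia Arc Q x y w
  PathVia-map h (edge a)      = edge a
  PathVia-map h (cons a py π) = cons a (h py) (PathVia-map h π)

  PathVia-++ : ∀ {P : Fin (suc m) → Set} {x y z w w′} →
    PathVia Arc P x y w → P y → PathVia Arc P y z w′ → PathVia Arc P x z w′
  PathVia-++ (edge a)      py ρ = cons a py ρ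
  PathVia-++ (cons a q π)  py ρ = cons a q (PathVia-++ π py ρ)

  PathVia-lastArc : ∀ {P : Fin (suc m) → Set} {x y w} → PathVia Arc P x y w → Arc w y
  PathVia-lastArc (edge a)     = a
  PathVia-lastArc (cons _ _ π) = PathVia-lastArc π

-- Ancestors and high paths in a depth-first tree.

module DepthFirst {m : ℕ} {Arc : Fin (suc m) → Fin (suc m) → Set}
                  {f : Fin (suc m) → Fin (suc m)} (dfsTree : IsDFSTree Arc f) where
  open IsDFSTree dfsTree

  V : Set
  V = Fin (suc m)

  infix 4 _≼_
  _≼_ : V → V → Set
  _≼_ = AncEq f

  ≼-trans : ∀ {x y z} → x ≼ y → y ≼ z → x ≼ z
  ≼-trans xy self        = xy
  ≼-trans xy (up z≢0 yz) = up z≢0 (≼-trans xy yz)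

  ≼⇒≤ : ∀ {u v} → u ≼ v → u ≤ v
  ≼⇒≤ = go (<-wellFounded _)
    where
    go : ∀ {u v} → Acc _<_ v → u ≼ v → u ≤ v
    go _ self = ≤-refl
    go {v = zero} _ (up 0≢0 _) = ⊥-elim (0≢0 refl)
    go {v = suc i} (acc rs) (up _ u≼fv) = ≤-trans (go (rs fv<v) u≼fv) (<⇒≤ fv<v)
      -- `preorder i` makes the parent an ancestor of the smaller vertex `inject₁ i`, where the
      -- induction hypothesis applies.
      where fv<v = ≤-inject₁⇒<-suc (go (rs (≤-inject₁⇒<-suc ≤-refl)) (preorder i))

  parent< : ∀ {v} → v ≢ zero → f v < v
  parent< {zero}  0≢0 = ⊥-elim (0≢0 refl)
  parent< {suc i} _   = ≤-inject₁⇒<-suc (≼⇒≤ (preorder i))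

  ≼-parent : ∀ {u v} → u ≼ v → u ≢ v → u ≼ f v
  ≼-parent self       u≢v = ⊥-elim (u≢v refl)
  ≼-parent (up _ u≼f) _   = u≼f

  -- The descendants of u form an interval of the preorder starting at u.
  ≼-interval : ∀ {u v w} → u ≼ w → u ≤ v → v ≤ w → u ≼ v
  ≼-interval = go (<-wellFounded _)
    where
    go : ∀ {u v w} → Acc _<_ w → u ≼ w → u ≤ v → v ≤ w → u ≼ v
    go {v = v} {w} _ u≼w u≤v v≤w with v ≟ w
    ... | yes refl = u≼w
    go {v = v} {zero} _ u≼w u≤v v≤w | no v≢w = ⊥-elim (v≢w (≤-antisym v≤w z≤n))
    go {v = v} {suc i} (acc rs) u≼w u≤v v≤w | no v≢w =
      go (rs (≤-inject₁⇒<-suc ≤-refl))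
         (≼-trans (≼-parent u≼w (<⇒≢ (≤-<-trans u≤v v<w))) (preorder i))
         u≤v (<-suc⇒≤-inject₁ v<w)
      where v<w = ≤∧≢⇒< v≤w v≢w

  ≼-comparable : ∀ {u v w} → u ≼ w → v ≼ w → u ≤ v → u ≼ v
  ≼-comparable u≼w v≼w u≤v = ≼-interval u≼w u≤v (≼⇒≤ v≼w)

  -- A forward arc stays in the subtree of `u` by the depth-first property; any other arc ends
  -- between `u` and `x`, inside the interval of descendants.
  ≼-arc : ∀ {u x y} → u ≼ x → Arc x y → u ≤ y → u ≼ y
  ≼-arc {x = x} {y} u≼x a u≤y with x <? y
  ... | yes x<y = ≼-trans u≼x (dfs x y a x<y)
  ... | no x≮y  = ≼-interval u≼x u≤y (≮⇒≥ x≮y)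

  descend : ∀ {P : V → Set} {x y z w} → x ≼ y → (∀ {q} → x ≤ q → P q) →
    PathVia Arc P y z w → PathVia Arc P x z w
  descend self h π = π
  descend x≼y@(up y≢0 x≼fy) h π = descend x≼fy h (cons (treeArcs _ y≢0) (h (≼⇒≤ x≼y)) π)

  -- Join the high path to `q`, the tree path down to `y` and the path to `v`: as `v < q`, all inner
  -- vertices exceed `v`, hence also `u`.
  HighPath-extend : ∀ {u q y v w} → HighPath Arc u q → u < v → v < q → q ≼ y →
    PathVia Arc (v <_) y v w → HighPath Arc u v
  HighPath-extend (_ , π) u<v v<q q≼y ρ =
    _ , PathVia-++ (PathVia-map (λ (u<i , q<i) → u<i , <-trans v<q q<i) π)
          (<-trans u<v v<q , v<q)
          (descend q≼y (λ q≤i → let v<i = <-≤-trans v<q q≤i in <-trans u<v v<i , v<i)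
            (PathVia-map (λ v<i → <-trans u<v v<i , v<i) ρ))

  HighPath-≼-last : ∀ {u v w} → HighPathLast Arc u v w → u ≼ w
  HighPath-≼-last = go self
    where
    go : ∀ {u v x w} → u ≼ x → PathVia Arc (λ i → u < i × v < i) x v w → u ≼ w
    go u≼x (edge a)               = u≼x
    go u≼x (cons a (u<y , _) π)   = go (≼-arc u≼x a (<⇒≤ u<y)) π

  -- While following the high path, maintain an ancestor x of the current vertex
  -- that is itself the end of a high path from u; x is replaced by the current
  -- vertex whenever the latter drops below x.
  HighPath-last : ∀ {u v w} → u < v → HighPathLast Arc u v w →
    w ≡ u ⊎ (v < w × ∃ λ x → v < x × x ≼ w × HighPath Arc u x)
  HighPath-last {u} {v} u<v = λ where
      (edge a)               → inj₁ refl
      (cons a (_ , v<y) π)   → inj₂ (go v<y (_ , v<y , self , _ , edge a) π)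
    where
    Covered : V → Set
    Covered y = ∃ λ x → v < x × x ≼ y × HighPath Arc u x

    go : ∀ {y w} → v < y → Covered y →
      PathVia Arc (λ i → u < i × v < i) y v w → v < w × Covered w
    go v<y c (edge a) = v<y , c
    go v<y (x , v<x , x≼y , hp) (cons {y = y′} a (_ , v<y′) π) with y′ <? x
    ... | yes y′<x = go v<y′
          (y′ , v<y′ , self , HighPath-extend hp (<-trans u<v v<y′) y′<x x≼y (edge a)) π
    ... | no y′≮x  = go v<y′ (x , v<x , ≼-arc x≼y a (≮⇒≥ y′≮x) , hp) π

  -- Semi-dominators and minima on tree paths.

  module SemiDominators {sd : V → V} (isSd : IsSd Arc f sd) where

    sd≤parent : ∀ {v} → v ≢ zero → sd v ≤ f v
    sd≤parent v≢0 = proj₂ (isSd _ v≢0) _ (_ , edge (treeArcs _ v≢0))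

    sd< : ∀ {v} → v ≢ zero → sd v < v
    sd< v≢0 = ≤-<-trans (sd≤parent v≢0) (parent< v≢0)

    sd≼ : ∀ {v} → v ≢ zero → sd v ≼ v
    sd≼ v≢0 with proj₁ (isSd _ v≢0)
    ... | _ , π = ≼-arc (HighPath-≼-last π) (PathVia-lastArc π) (<⇒≤ (sd< v≢0))

    -- If `sd q < v`, the high path from `sd q` to `q` extends to `v`; otherwise `sd v < v ≤ sd q`.
    sd≤sd : ∀ {v q y w} → v ≢ zero → v < q → q ≼ y → PathVia Arc (v <_) y v w → sd v ≤ sd q
    sd≤sd {v} {q} v≢0 v<q q≼y ρ with sd q <? v
    ... | yes sdq<v = proj₂ (isSd _ v≢0) _
            (HighPath-extend (proj₁ (isSd _ (<⇒≢0 v<q))) sdq<v v<q q≼y ρ)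
    ... | no sdq≮v  = ≤-trans (<⇒≤ (sd< v≢0)) (≮⇒≥ sdq≮v)

    Better : V → V → Set
    Better k x = (sd k < sd x) ⊎ ((sd k ≡ sd x) × (k ≤ x))

    Better⇒≤ : ∀ {k x} → Better k x → sd k ≤ sd x
    Better⇒≤ (inj₁ lt)       = <⇒≤ lt
    Better⇒≤ (inj₂ (eq , _)) = ≤-reflexive eq

    Better-reverse : ∀ {k x} → Better k x → sd x ≤ sd k → k ≤ x
    Better-reverse (inj₁ lt)       le = ⊥-elim (<⇒≱ lt le)
    Better-reverse (inj₂ (_ , le)) _  = le

    -- `rd v` is the case `a = sd v`, `z = v`. With free endpoints, relative dominators of different
    -- vertices can be compared on one path.
    record Argmin (a z k : V) : Set where
      constructor argmin
      field
        above : a < k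
        below : k ≼ z
        least : ∀ {x} → a < x → x ≼ z → Better k x
    open Argmin

    Argmin-mono-sd : ∀ {a a′ z k k′} → a′ ≤ a → Argmin a z k → Argmin a′ z k′ → sd k′ ≤ sd k
    Argmin-mono-sd a′≤a A A′ = Better⇒≤ (least A′ (≤-<-trans a′≤a (above A)) (below A))

    Argmin-mono : ∀ {a a′ z k k′} → a′ ≤ a → Argmin a z k → Argmin a′ z k′ → k′ ≤ k
    Argmin-mono {k = k} {k′} a′≤a A A′ with k <? k′
    ... | no k≮k′  = ≮⇒≥ k≮k′
    ... | yes k<k′ = Better-reverse (least A′ (≤-<-trans a′≤a (above A)) (below A))
                       (Better⇒≤ (least A (<-trans (above A) k<k′) (below A′)))

    Argmin-unique : ∀ {a a′ z k k′} → a ≡ a′ → Argmin a z k → Argmin a′ z k′ → k ≡ k′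
    Argmin-unique refl A A′ = ≤-antisym (Argmin-mono ≤-refl A′ A) (Argmin-mono ≤-refl A A′)

    -- A minimiser beyond `z` could at best tie with `z`, and ties go to the smaller vertex.
    Argmin-restrict : ∀ {a v z k} → z ≼ v → a < z → (∀ {x} → z < x → x ≼ v → sd z ≤ sd x) →
      Argmin a v k → Argmin a z k
    Argmin-restrict {z = z} {k} z≼v a<z low A =
      argmin (above A) (≼-comparable (below A) z≼v k≤z)
        (λ a<x x≼z → least A a<x (≼-trans x≼z z≼v))
      where
      k≤z : k ≤ z
      k≤z with z <? k
      ... | no z≮k  = ≮⇒≥ z≮k
      ... | yes z<k = Better-reverse (least A a<z z≼v) (low z<k (below A))

    minimum : ∀ {z v} → z ≼ v → z < v →
      ∃ λ u → z < u × u ≼ v × (∀ {x} → z < x → x ≼ v → sd u ≤ sd x)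
    minimum self z<z = ⊥-elim (<-irrefl refl z<z)
    minimum {z} {v} (up v≢0 z≼fv) z<v with z ≟ f v
    ... | yes refl = v , z<v , self , low
      where
      low : ∀ {x} → z < x → x ≼ v → sd v ≤ sd x
      low z<x self         = ≤-refl
      low z<x (up _ x≼fv)  = ⊥-elim (<⇒≱ z<x (≼⇒≤ x≼fv))
    ... | no z≢fv with minimum z≼fv (≤∧≢⇒< (≼⇒≤ z≼fv) z≢fv)
    ...   | u , z<u , u≼fv , low with ≤-total (sd u) (sd v)
    ...     | inj₁ u≤v = u , z<u , up v≢0 u≼fv , λ where
                _ self          → u≤v
                z<x (up _ x≼fv) → low z<x x≼fv
    ...     | inj₂ v≤u = v , z<v , self , λ where
                _ self          → ≤-refl
                z<x (up _ x≼fv) → ≤-trans v≤u (low z<x x≼fv)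

    -- Relative dominators and alternation along `rd`.

    module RelativeDominators {rd : V → V} (isRd : IsRd Arc f sd rd) where

      rd-argmin : ∀ {v} → v ≢ zero → Argmin (sd v) v (rd v)
      rd-argmin {v} v≢0 with isRd v v≢0
      ... | (rd≼v , rd≢0 , sd≼f) , best =
        argmin (≤-<-trans (≼⇒≤ sd≼f) (parent< rd≢0)) rd≼v
          λ sdv<x x≼v → best _ (x≼v , <⇒≢0 sdv<x ,
            ≼-parent (≼-comparable (sd≼ v≢0) x≼v (<⇒≤ sdv<x)) (<⇒≢ sdv<x))

      sd-rd≤ : ∀ {v} → v ≢ zero → sd (rd v) ≤ sd v
      sd-rd≤ v≢0 = Better⇒≤ (least (rd-argmin v≢0) (sd< v≢0) self)

      module Alternation {t : V → Bool} {c : Bool}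
        (t-same : ∀ {v} → v ≢ zero → sd (rd v) ≡ sd v → t v ≡ c)
        (t-flip : ∀ {v} → v ≢ zero → sd (rd v) ≢ sd v → t v ≡ not (t (rd v))) where

        -- Both rules for `t` see `v` only through `sd v` and `rd v`.
        t-cong : ∀ {x y} → x ≢ zero → y ≢ zero → sd x ≡ sd y → rd x ≡ rd y → t x ≡ t y
        t-cong {x} {y} x≢0 y≢0 sd≡ rd≡ with sd (rd x) ≟ sd x
        ... | yes eq = trans (t-same x≢0 eq)
                (sym (t-same y≢0 (trans (cong sd (sym rd≡)) (trans eq sd≡))))
        ... | no ne  = trans (t-flip x≢0 ne) (trans (cong (not ∘ t) rd≡)
                (sym (t-flip y≢0 (λ eq → ne (trans (cong sd rd≡) (trans eq (sym sd≡)))))))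

        -- The configuration reproduces itself one step up the rd-chains, with the
        -- vertices rd vᵢ in place of vᵢ and rd v₃ in place of z.
        t-convex : ∀ {z v₁ v₂ v₃} → v₁ ≢ zero → v₂ ≢ zero → v₃ ≢ zero →
          sd v₂ ≤ sd v₁ → sd v₃ ≤ sd v₂ →
          Argmin (sd v₁) z (rd v₁) → Argmin (sd v₂) z (rd v₂) → Argmin (sd v₃) z (rd v₃) →
          sd (rd v₁) ≤ sd v₃ → t v₁ ≡ t v₃ → t v₂ ≡ t v₃
        t-convex = go (<-wellFounded _)
          where
          go : ∀ {z v₁ v₂ v₃} → Acc _<_ v₃ → v₁ ≢ zero → v₂ ≢ zero → v₃ ≢ zero →
            sd v₂ ≤ sd v₁ → sd v₃ ≤ sd v₂ →
            Argmin (sd v₁) z (rd v₁) → Argmin (sd v₂) z (rd v₂) → Argmin (sd v₃) z (rd v₃) →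
            sd (rd v₁) ≤ sd v₃ → t v₁ ≡ t v₃ → t v₂ ≡ t v₃
          go {z} {v₁} {v₂} {v₃} (acc rs) v₁≢0 v₂≢0 v₃≢0 s₂≤s₁ s₃≤s₂ A₁ A₂ A₃ κ₁≤s₃ t₁≡t₃
            with sd v₂ ≟ sd v₃
          ... | yes s₂≡s₃ = t-cong v₂≢0 v₃≢0 s₂≡s₃ (Argmin-unique s₂≡s₃ A₂ A₃)
          ... | no s₂≢s₃ = trans (t-flip v₂≢0 κ₂≢s₂) (trans (cong not κ-agree) (sym t₃≡))
            where
            k₁ = rd v₁
            k₂ = rd v₂
            k₃ = rd v₃
            s₃<s₂ : sd v₃ < sd v₂
            s₃<s₂ = ≤∧≢⇒< s₃≤s₂ (s₂≢s₃ ∘ sym)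
            κ₂≤κ₁ : sd k₂ ≤ sd k₁
            κ₂≤κ₁ = Argmin-mono-sd s₂≤s₁ A₁ A₂
            κ₃≤κ₂ : sd k₃ ≤ sd k₂
            κ₃≤κ₂ = Argmin-mono-sd s₃≤s₂ A₂ A₃
            κ₁≢s₁ : sd k₁ ≢ sd v₁
            κ₁≢s₁ = <⇒≢ (≤-<-trans κ₁≤s₃ (<-≤-trans s₃<s₂ s₂≤s₁))
            κ₂≢s₂ : sd k₂ ≢ sd v₂
            κ₂≢s₂ = <⇒≢ (≤-<-trans κ₂≤κ₁ (≤-<-trans κ₁≤s₃ s₃<s₂))
            k₁≢0 = <⇒≢0 (above A₁)
            k₂≢0 = <⇒≢0 (above A₂)
            k₃≢0 = <⇒≢0 (above A₃)

            -- `k₃` minimises over the longest of the three ranges, so nothing beyond it has smaller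
            -- `sd` and `Argmin-restrict` cuts the path at `k₃`.
            lift : ∀ {v} → sd v₃ ≤ sd v → sd (rd v) ≤ sd v₃ → Argmin (sd v) z (rd v) →
              Argmin (sd (rd v)) k₃ (rd (rd v))
            lift s₃≤s κ≤s₃ A = Argmin-restrict
              (≼-comparable (below A₃) (below A) (Argmin-mono s₃≤s A A₃))
              (≤-<-trans κ≤s₃ (above A₃))
              (λ k₃<x x≼k → Better⇒≤ (least A₃ (<-trans (above A₃) k₃<x) (≼-trans x≼k (below A))))
              (rd-argmin (<⇒≢0 (above A)))

            B₁ = lift (≤-trans s₃≤s₂ s₂≤s₁) κ₁≤s₃ A₁
            B₂ = lift s₃≤s₂ (≤-trans κ₂≤κ₁ κ₁≤s₃) A₂
            B₃ = lift ≤-refl (≤-trans κ₃≤κ₂ (≤-trans κ₂≤κ₁ κ₁≤s₃)) A₃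

            t₁≡ : t v₁ ≡ not (t k₁)
            t₁≡ = t-flip v₁≢0 κ₁≢s₁

            -- Equality would make `sd k₁` equal to `sd v₃` too and stop the descent at `k₁`, so
            -- `t k₁` and `t v₃` are both `c`, while `t v₁` is the opposite.
            κ₃≢s₃ : sd k₃ ≢ sd v₃
            κ₃≢s₃ κ₃≡s₃ =
              not-¬ (trans (t-same v₃≢0 κ₃≡s₃) (sym t-k₁)) (trans (sym t₁≡t₃) t₁≡)
              where
              κ₁≡s₃ : sd k₁ ≡ sd v₃
              κ₁≡s₃ = ≤-antisym κ₁≤s₃
                (≤-trans (≤-reflexive (sym κ₃≡s₃)) (≤-trans κ₃≤κ₂ κ₂≤κ₁))
              t-k₁ : t k₁ ≡ c
              t-k₁ = t-same k₁≢0 (≤-antisym (sd-rd≤ k₁≢0)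
                (≤-trans (≤-reflexive (trans κ₁≡s₃ (sym κ₃≡s₃)))
                  (Better⇒≤ (least A₃
                    (≤-<-trans (≤-reflexive (sym κ₁≡s₃)) (above B₁))
                    (≼-trans (below B₁) (below A₃))))))

            k₃<v₃ : k₃ < v₃
            k₃<v₃ = ≤∧≢⇒< (≼⇒≤ (below (rd-argmin v₃≢0))) (κ₃≢s₃ ∘ cong sd)

            t₃≡ : t v₃ ≡ not (t k₃)
            t₃≡ = t-flip v₃≢0 κ₃≢s₃

            κ-agree : t k₂ ≡ t k₃
            κ-agree = go (rs k₃<v₃) k₁≢0 k₂≢0 k₃≢0 κ₂≤κ₁ κ₃≤κ₂ B₁ B₂ B₃
              (Better⇒≤ (least B₁ (≤-<-trans κ₁≤s₃ (above A₃)) self))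
              (not-injective (trans (sym t₁≡) (trans t₁≡t₃ t₃≡)))

        -- Acyclicity of the parent map `p`.

        module Parents {g : V → V} (isG : IsG Arc f sd g) {p : V → V}
          (p-true  : ∀ {v} → v ≢ zero → t v ≡ true → p v ≡ g v)
          (p-false : ∀ {v} → v ≢ zero → t v ≡ false → p v ≡ f v) where

          -- The ancestor `x` from `HighPath-last` is reached by a high path from `sd v`, so
          -- `sd x ≤ sd v`; the arc from `g v` to `v` gives the converse by `sd≤sd`.
          g-cases : ∀ {v} → v ≢ zero →
            g v ≡ sd v ⊎ (v < g v × ∃ λ x → v < x × x ≼ g v × sd x ≡ sd v)
          g-cases {v} v≢0 = map₂ (λ (v<g , x , v<x , x≼g , hp) →
              v<g , x , v<x , x≼g ,
                ≤-antisym (proj₂ (isSd _ (<⇒≢0 v<x)) _ hp)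
                          (sd≤sd v≢0 v<x x≼g (edge (PathVia-lastArc (isG _ v≢0)))))
            (HighPath-last (sd< v≢0) (isG _ v≢0))

          -- Moving from `v` to `g v` thus adds no ancestor whose `sd` is below `sd v`.
          ≼g⇒ : ∀ {v x} → v ≢ zero → x ≼ g v → x ≼ v ⊎ sd v ≤ sd x
          ≼g⇒ {v} {x} v≢0 x≼g with g-cases v≢0
          ... | inj₁ g≡sd = inj₁ (≼-trans (subst (x ≼_) g≡sd x≼g) (sd≼ v≢0))
          ... | inj₂ (v<g , _) with v <? x
          ...   | yes v<x = inj₂ (sd≤sd v≢0 v<x x≼g (edge (PathVia-lastArc (isG _ v≢0))))
          ...   | no v≮x  = inj₁ (≼-interval x≼g (≮⇒≥ v≮x) (<⇒≤ v<g))

          p-arc : ∀ {v} → v ≢ zero → Arc (p v) v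
          p-arc {v} v≢0 with t v in tv
          ... | true  = subst (λ x → Arc x v) (sym (p-true v≢0 tv)) (PathVia-lastArc (isG _ v≢0))
          ... | false = subst (λ x → Arc x v) (sym (p-false v≢0 tv)) (treeArcs _ v≢0)

          -- At least one step is taken, so `LeadsTo z (p z)` with `z < p z` is a cycle with minimum
          -- `z`.
          data LeadsTo (z : V) : V → Set where
            last : ∀ {v} → p v ≡ z → LeadsTo z v
            next : ∀ {v} → z < p v → LeadsTo z (p v) → LeadsTo z v

          LeadsTo⇒≼ : ∀ {z v} → z < v → LeadsTo z v → z ≼ v
          LeadsTo⇒≼ z<v (last refl)    = ≼-arc self (p-arc (<⇒≢0 z<v)) (<⇒≤ z<v)
          LeadsTo⇒≼ z<v (next z<pv ℓ) = ≼-arc (LeadsTo⇒≼ z<pv ℓ) (p-arc (<⇒≢0 z<v)) (<⇒≤ z<v)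

          module _ {z : V} (z≢0 : z ≢ zero) where

            -- Ties for `u` are left open: given a path back to `z` above `z`, tied minima have the
            -- same relative dominator by `rd-restrict`, hence the same `t`.
            record Good (v : V) : Set where
              constructor good
              field
                {u}  : V
                z<u  : z < u
                u≼v  : u ≼ v
                su<z : sd u < z
                low  : ∀ {x} → z < x → x ≼ v → sd u ≤ sd x
                tu   : t u ≡ true

            private
              rd-restrict : ∀ {x y w} → z ≼ y → z < x → x ≼ y → PathVia Arc (z <_) y z w →
                sd x < z → Argmin (sd x) z (rd x)
              rd-restrict z≼y z<x x≼y π sx<z = Argmin-restrict
                (≼-comparable z≼y x≼y (<⇒≤ z<x)) sx<z
                (λ z<q q≼x → sd≤sd z≢0 z<q (≼-trans q≼x x≼y) π)
                (rd-argmin (<⇒≢0 z<x))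

            Good-start : t z ≡ true → z ≼ p z → z < p z → Good (p z)
            Good-start tz z≼pz z<pz with g-cases z≢0 | p-true z≢0 tz
            ... | inj₁ g≡sd | p≡g =
              ⊥-elim (<⇒≱ (sd< z≢0) (<⇒≤ (subst (z <_) (trans p≡g g≡sd) z<pz)))
            -- The witness `x` attains the minimum `sd z` and shares the relative dominator of `z`,
            -- so it inherits `t z`.
            ... | inj₂ (z<g , x , z<x , x≼g , sx≡sz) | p≡g =
              subst Good (sym p≡g) (good z<x x≼g sx<z
                (λ z<y y≼g → ≤-trans (≤-reflexive sx≡sz) (sd≤sd z≢0 z<y y≼g π))
                (trans (t-cong (<⇒≢0 z<x) z≢0 sx≡sz
                  (Argmin-unique sx≡sz (rd-restrict z≼g z<x x≼g π sx<z) (rd-argmin z≢0))) tz))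
              where
              z≼g = subst (z ≼_) p≡g z≼pz
              π = edge (PathVia-lastArc (isG _ z≢0))
              sx<z = ≤-<-trans (≤-reflexive sx≡sz) (sd< z≢0)

            Good-step : ∀ {v w} → z < v → z ≼ v → z ≼ p v → PathVia Arc (z <_) v z w →
              Good v → Good (p v)
            Good-step {v} z<v z≼v z≼pv π (good {u} z<u u≼v su<z low tu) with t v in tv
            ... | false = subst Good (sym (p-false v≢0 tv))
                    (good z<u (≼-parent u≼v u≢v) su<z (λ z<x x≼f → low z<x (up v≢0 x≼f)) tu)
              where
              v≢0 = <⇒≢0 z<v
              u≢v : u ≢ v
              u≢v refl = not-¬ refl (trans (sym tu) tv)
            ... | true = subst Good (sym p≡g) good-g
              where
              v≢0 = <⇒≢0 z<v
              u≢0 = <⇒≢0 z<u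
              p≡g = p-true v≢0 tv
              z≼g : z ≼ g v
              z≼g = subst (z ≼_) p≡g z≼pv
              rd-u : Argmin (sd u) z (rd u)
              rd-u = rd-restrict z≼v z<u u≼v π su<z

              good-g : Good (g v)
              good-g with sd v <? z
              ... | no sv≮z with sd v <? u
              -- Here `u` is an ancestor of `sd v`, hence of `g v`; new ancestors have `sd` at least
              -- `sd v ≥ z`.
              ...   | no sv≮u = good z<u
                        (≼-trans (≼-comparable u≼v (sd≼ v≢0) (≮⇒≥ sv≮u)) (HighPath-≼-last (isG _ v≢0)))
                        su<z low′ tu
                where
                low′ : ∀ {x} → z < x → x ≼ g v → sd u ≤ sd x
                low′ z<x x≼g with ≼g⇒ v≢0 x≼g
                ... | inj₁ x≼v   = low z<x x≼v
                ... | inj₂ sv≤sx = ≤-trans (<⇒≤ su<z) (≤-trans (≮⇒≥ sv≮z) sv≤sx)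
              -- Here `u` competes for `rd v`, so `rd v` ties with `u` and has `t` true; the strict
              -- drop of `sd` then makes `t v` false.
              ...   | yes sv<u = ⊥-elim (not-¬ refl (trans (sym tv) (trans tv≡ (cong not tk))))
                where
                k = rd v
                A = rd-argmin v≢0
                z<k : z < k
                z<k = ≤-<-trans (≮⇒≥ sv≮z) (above A)
                sk≡su : sd k ≡ sd u
                sk≡su = ≤-antisym (Better⇒≤ (least A sv<u u≼v)) (low z<k (below A))
                sk<z : sd k < z
                sk<z = ≤-<-trans (≤-reflexive sk≡su) su<z
                tv≡ : t v ≡ not (t k)
                tv≡ = t-flip v≢0 (<⇒≢ (<-≤-trans sk<z (≮⇒≥ sv≮z)))
                tk : t k ≡ true
                tk = trans (t-cong (<⇒≢0 z<k) u≢0 sk≡su (Argmin-unique sk≡su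
                  (rd-restrict z≼v z<k (below A) π sk<z) rd-u)) tu
              good-g | yes sv<z with g-cases v≢0
              ... | inj₁ g≡sd = ⊥-elim (<⇒≱ sv<z (subst (z ≤_) g≡sd (≼⇒≤ z≼g)))
              ... | inj₂ (v<g , x , v<x , x≼g , sx≡sv) with minimum z≼g (<-trans z<v v<g)
              ...   | u′ , z<u′ , u′≼g , low′ =
                -- Convexity for `v`, `u′`, `u`: the new minimum satisfies `sd u ≤ sd u′ ≤ sd v`,
                -- and `sd (rd v) ≤ sd z ≤ sd u`.
                good z<u′ u′≼g su′<z low′
                  (trans (t-convex v≢0 (<⇒≢0 z<u′) u≢0 su′≤sv su≤su′
                    rd-v (rd-restrict z≼g z<u′ u′≼g π′ su′<z) rd-u
                    (≤-trans (Better⇒≤ (least rd-v sv<z self)) (sd≤sd z≢0 z<u u≼v π))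
                    (trans tv (sym tu))) tu)
                where
                π′ = cons (PathVia-lastArc (isG _ v≢0)) z<v π
                rd-v = rd-restrict z≼v z<v self π sv<z
                su′≤sv : sd u′ ≤ sd v
                su′≤sv = ≤-trans (low′ (<-trans z<v v<x) x≼g) (≤-reflexive sx≡sv)
                su′<z : sd u′ < z
                su′<z = ≤-<-trans su′≤sv sv<z
                su≤su′ : sd u ≤ sd u′
                su≤su′ with ≼g⇒ v≢0 u′≼g
                ... | inj₁ u′≼v   = low z<u′ u′≼v
                ... | inj₂ sv≤su′ = ≤-trans (low z<v self) sv≤su′

            Good⇒¬LeadsTo : ∀ {v w} → z < v → PathVia Arc (z <_) v z w → Good v → ¬ LeadsTo z v
            Good⇒¬LeadsTo z<v π gd ℓ@(last p≡z) =
              -- Goodness has reached `z` itself, where `u` would be both above `z` and an ancestor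
              -- of `z`.
              <⇒≱ (Good.z<u gd′) (≼⇒≤ (subst (Good.u gd′ ≼_) p≡z (Good.u≼v gd′)))
              where
              gd′ = Good-step z<v (LeadsTo⇒≼ z<v ℓ) (subst (z ≼_) (sym p≡z) self) π gd
            Good⇒¬LeadsTo z<v π gd ℓ@(next z<pv ℓ′) =
              Good⇒¬LeadsTo z<pv (cons (p-arc (<⇒≢0 z<v)) z<v π)
                (Good-step z<v (LeadsTo⇒≼ z<v ℓ) (LeadsTo⇒≼ z<pv ℓ′) π gd) ℓ′

            no-cycle : z < p z → ¬ LeadsTo z (p z)
            no-cycle z<pz ℓ with t z in tz
            ... | true  = Good⇒¬LeadsTo z<pz (edge (p-arc z≢0))
                            (Good-start tz (LeadsTo⇒≼ z<pz ℓ) z<pz) ℓ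
            ... | false = <⇒≱ (parent< z≢0) (<⇒≤ (subst (z <_) (p-false z≢0 tz) z<pz))

            p≢self : p z ≢ z
            p≢self p≡z with t z in tz
            ... | false = <⇒≢ (parent< z≢0) (trans (sym (p-false z≢0 tz)) p≡z)
            ... | true with g-cases z≢0 | trans (sym (p-true z≢0 tz)) p≡z
            ...   | inj₁ g≡sd      | g≡z = <⇒≢ (sd< z≢0) (trans (sym g≡sd) g≡z)
            ...   | inj₂ (z<g , _) | g≡z = <⇒≢ z<g (sym g≡z)

          -- From acyclicity to a spanning tree.

          data Escapes (z : V) : V → Set where
            last : ∀ {v} → p v ≤ z → Escapes z v
            next : ∀ {v} → z < p v → Escapes z (p v) → Escapes z v

          Escapes-split : ∀ {i v} → Escapes (suc i) v → Escapes (inject₁ i) v ⊎ LeadsTo (suc i) v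
          Escapes-split {i} {v} (last pv≤z) with p v ≟ suc i
          ... | yes pv≡z = inj₂ (last pv≡z)
          ... | no pv≢z  = inj₁ (last (<-suc⇒≤-inject₁ (≤∧≢⇒< pv≤z pv≢z)))
          Escapes-split {i} (next z<pv e) with Escapes-split e
          ... | inj₁ e′ = inj₁ (next (<-trans (≤-inject₁⇒<-suc ≤-refl) z<pv) e′)
          ... | inj₂ ℓ  = inj₂ (next z<pv ℓ)

          LeadsTo-Escapes : ∀ {i v} → LeadsTo (suc i) v → Escapes (inject₁ i) (suc i) →
            Escapes (inject₁ i) v
          LeadsTo-Escapes {i} (last p≡z) e =
            next (subst (inject₁ i <_) (sym p≡z) (≤-inject₁⇒<-suc ≤-refl))
                 (subst (Escapes (inject₁ i)) (sym p≡z) e)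
          LeadsTo-Escapes {i} (next z<pv ℓ) e =
            next (<-trans (≤-inject₁⇒<-suc ≤-refl) z<pv) (LeadsTo-Escapes ℓ e)

          -- Lower the threshold from `suc i` to `inject₁ i`: a walk can newly stop only at `suc i`,
          -- and from there `no-cycle` and `p≢self` forbid a return. At threshold `zero` the walk
          -- reaches the root.
          escapes : ∀ z v → z < v → Escapes z v
          escapes = >-weakInduction (λ z → ∀ v → z < v → Escapes z v) top down
            where
            top : ∀ v → fromℕ m < v → Escapes (fromℕ m) v
            top v m<v = ⊥-elim (<⇒≱ m<v (≤fromℕ v))

            at-suc : ∀ i → (∀ v → suc i < v → Escapes (suc i) v) → Escapes (inject₁ i) (suc i)
            at-suc i ih with <-cmp (p (suc i)) (suc i)
            ... | tri< p<z _ _ = last (<-suc⇒≤-inject₁ p<z)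
            ... | tri≈ _ p≡z _ = ⊥-elim (p≢self (λ ()) p≡z)
            ... | tri> _ _ z<p with Escapes-split (ih _ z<p)
            ...   | inj₁ e = next (<-trans (≤-inject₁⇒<-suc ≤-refl) z<p) e
            ...   | inj₂ ℓ = ⊥-elim (no-cycle (λ ()) z<p ℓ)

            down : ∀ i → (∀ v → suc i < v → Escapes (suc i) v) →
              ∀ v → inject₁ i < v → Escapes (inject₁ i) v
            down i ih v i<v with <-cmp v (suc i)
            ... | tri< v<z _ _  = ⊥-elim (<⇒≱ i<v (<-suc⇒≤-inject₁ v<z))
            ... | tri≈ _ refl _ = at-suc i ih
            ... | tri> _ _ z<v with Escapes-split (ih v z<v)
            ...   | inj₁ e = e
            ...   | inj₂ ℓ = LeadsTo-Escapes ℓ (at-suc i ih)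

          spanningTree : IsSpanningTreeFrom0 p
          spanningTree v with v ≟ zero
          ... | yes refl = root
          ... | no v≢0   = go v≢0 (escapes zero v (≤∧≢⇒< z≤n (v≢0 ∘ sym)))
            where
            go : ∀ {v} → v ≢ zero → Escapes zero v → Reach p v
            go v≢0 (last p≤0)   = step v≢0 (subst (Reach p) (sym (≤-antisym p≤0 z≤n)) root)
            go v≢0 (next 0<p e) = step v≢0 (go (<⇒≢0 0<p) e)

theorem36 : (m : ℕ) (Arc : Fin (suc m) → Fin (suc m) → Set)
    → IsFlowGraph Arc
    → (f : Fin (suc m) → Fin (suc m)) → IsDFSTree Arc f
    → (sd rd g : Fin (suc m) → Fin (suc m))
    → IsSd Arc f sd → IsRd Arc f sd rd → IsG Arc f sd g
    → (b r : Fin (suc m) → Fin (suc m)) → IsBR Arc f sd rd g b r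
    → IsSpanningTreeFrom0 b × IsSpanningTreeFrom0 r
theorem36 m Arc _ f dfsTree sd rd g isSd isRd isG b r isBR =
    Parents.spanningTree {t = blue} same flip isG
      (λ v≢0 eq → proj₁ (blue-true v≢0 eq)) (λ v≢0 eq → proj₁ (blue-false v≢0 eq))
  , Parents.spanningTree {t = not ∘ blue}
      (λ v≢0 eq → cong not (same v≢0 eq)) (λ v≢0 ne → cong not (flip v≢0 ne))
      isG
      (λ v≢0 eq → proj₂ (blue-false v≢0 (not-injective eq)))
      (λ v≢0 eq → proj₂ (blue-true v≢0 (not-injective eq)))
  where
  open DepthFirst dfsTree
  open SemiDominators isSd
  open RelativeDominators isRd
  open Alternation using (module Parents)

  cond? : ∀ v → Dec (Cond Arc f sd rd b v)
  cond? v = (sd v ≟ sd (rd v)) ⊎-dec (b (rd v) ≟ f (rd v))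

  blue : V → Bool
  blue v = does (cond? v)

  blue-true : ∀ {v} → v ≢ zero → blue v ≡ true → (b v ≡ g v) × (r v ≡ f v)
  blue-true {v} v≢0 eq = proj₁ (isBR v v≢0) (invert (subst (Reflects _) eq (proof (cond? v))))

  blue-false : ∀ {v} → v ≢ zero → blue v ≡ false → (b v ≡ f v) × (r v ≡ g v)
  blue-false {v} v≢0 eq = proj₂ (isBR v v≢0) (invert (subst (Reflects _) eq (proof (cond? v))))

  same : ∀ {v} → v ≢ zero → sd (rd v) ≡ sd v → blue v ≡ true
  same {v} _ eq = dec-true (cond? v) (inj₁ (sym eq))

  -- This excludes that `b` equals `f` at a blue `rd v` when `sd` drops strictly: since `f` is
  -- smaller than `rd v`, `g` must be its semi-dominator, and the parent of `rd v` is at least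
  -- `sd v`.
  g≡f⇒sd≡ : ∀ {v} → v ≢ zero → g (rd v) ≡ f (rd v) → sd (rd v) ≡ sd v
  g≡f⇒sd≡ {v} v≢0 g≡f with isRd v v≢0
  ... | (_ , rd≢0 , sd≼f) , _ with HighPath-last (sd< rd≢0) (isG _ rd≢0)
  ...   | inj₁ g≡sd = ≤-antisym (sd-rd≤ v≢0)
            (≤-trans (≼⇒≤ sd≼f) (≤-reflexive (trans (sym g≡f) g≡sd)))
  ...   | inj₂ (rd<g , _) = ⊥-elim (<⇒≱ (parent< rd≢0) (subst (rd v ≤_) g≡f (<⇒≤ rd<g)))

  flip : ∀ {v} → v ≢ zero → sd (rd v) ≢ sd v → blue v ≡ not (blue (rd v))
  flip {v} v≢0 ne with blue (rd v) in eq
  ... | false = dec-true (cond? v) (inj₂ (proj₁ (blue-false rd≢0 eq)))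
    where rd≢0 = proj₁ (proj₂ (proj₁ (isRd v v≢0)))
  ... | true = dec-false (cond? v) λ where
          (inj₁ eq′)  → ne (sym eq′)
          (inj₂ b≡f) → ne (g≡f⇒sd≡ v≢0 (trans (sym (proj₁ (blue-true rd≢0 eq))) b≡f))
    where rd≢0 = proj₁ (proj₂ (proj₁ (isRd v v≢0)))
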